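{- Let $d,r$ be positive integers, $n=dr$, and let $\gamma\in\mathcal S_n$ have cycle structure $d^r$. Suppose $(\varepsilon,\varepsilon,\gamma;(123))\in\mathrm{Par}(n)$. Then: <ul> <li>(i) if $3\mid d$ then $3\mid r$;</li> <li>(ii) if $6\mid d$ then $6\mid r$.</li> </ul>
   Context: A Latin square of order $n$ is an $n\times n$ array with rows, columns and symbols indexed by $[n]$, each symbol occurring once in each row and each column, with triple set $O(L)$. Permutations act on the right; $\varepsilon$ is the identity. A paratopism $(\alpha,\beta,\gamma;(123))$ maps $L$ to $L^\sigma$ with triple set $\{(z\gamma,x\alpha,y\beta):(x,y,z)\in O(L)\}$; it is an autoparatopism of $L$ if $L^\sigma=L$. $\mathrm{Par}(n)$ is the set of paratopisms that are autoparatopisms of at least one Latin square of order $n$. -}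

module Defs where

open import Data.Fin.Base using (Fin; toℕ)
open import Data.Fin.Patterns using (0F; 1F; 2F)
open import Data.Fin.Permutation using (Permutation′; permutation; _⟨$⟩ʳ_; _⟨$⟩ˡ_)
open import Data.Nat.Base using (ℕ; suc; NonZero)
open import Data.Nat.DivMod using (_mod_)
open import Data.Product using (∃; ∃!; _×_; _,_)
open import Data.Vec.Base using (Vec; []; _∷_; lookup; tabulate)
open import Function.Bundles using (_↔_; Inverse)
open import Level using (0ℓ)
open import Relation.Binary.PropositionalEquality using (_≡_; refl)
open import Relation.Unary using (Pred; _∈_; _≐_)

record LatinSquare (n : ℕ) : Set where
  field
    entry : Fin n → Fin n → Fin n
    row   : ∀ x z → ∃! _≡_ λ y → entry x y ≡ z
    col   : ∀ y z → ∃! _≡_ λ x → entry x y ≡ z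

Triple : ℕ → Set
Triple n = Vec (Fin n) 3

O : ∀ {n} → LatinSquare n → Pred (Triple n) 0ℓ
O L (x ∷ y ∷ z ∷ []) = LatinSquare.entry L x y ≡ z

record Paratopism (n : ℕ) : Set where
  constructor ⟨_,_,_⨾_⟩
  field
    α β γ : Permutation′ n
    δ     : Permutation′ 3

-- The coordinate in position j is moved by the j-th permutation and then
-- put in position jδ.
act : ∀ {n} → Paratopism n → Triple n → Triple n
act ⟨ α , β , γ ⨾ δ ⟩ t =
  tabulate λ i → let j = δ ⟨$⟩ˡ i in lookup (α ∷ β ∷ γ ∷ []) j ⟨$⟩ʳ lookup t j

-- The cycle (123) on positions, which are numbered 0, 1, 2 here.
[123] : Permutation′ 3
[123] = permutation
  (λ { 0F → 1F ; 1F → 2F ; 2F → 0F })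
  (λ { 0F → 2F ; 1F → 0F ; 2F → 1F })
  (λ { 0F → refl ; 1F → refl ; 2F → refl })
  (λ { 0F → refl ; 1F → refl ; 2F → refl })

act-[123] : ∀ {n} (α β γ : Permutation′ n) x y z →
            act ⟨ α , β , γ ⨾ [123] ⟩ (x ∷ y ∷ z ∷ []) ≡
            (γ ⟨$⟩ʳ z) ∷ (α ⟨$⟩ʳ x) ∷ (β ⟨$⟩ʳ y) ∷ []
act-[123] α β γ x y z = refl

-- The triple set of L^σ.
O^ : ∀ {n} → LatinSquare n → Paratopism n → Pred (Triple n) 0ℓ
O^ L σ u = ∃ λ t → t ∈ O L × act σ t ≡ u

IsAutoparatopism : ∀ {n} → Paratopism n → LatinSquare n → Set
IsAutoparatopism σ L = O^ L σ ≐ O L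

Par : ∀ n → Pred (Paratopism n) 0ℓ
Par n σ = ∃ λ (L : LatinSquare n) → IsAutoparatopism σ L

-- Cycle structure d^r: the points are partitioned into r cycles
-- (c₀ c₁ … c_{d-1}) of length d, the k-th of which lists the points
-- point (k , 0), …, point (k , d-1).
record HasCycleStructure {n : ℕ} (π : Permutation′ n)
                         (d r : ℕ) .{{_ : NonZero d}} : Set where
  field
    cycles : (Fin r × Fin d) ↔ Fin n

  point : Fin r × Fin d → Fin n
  point = Inverse.to cycles

  field
    cyclic : ∀ k i → π ⟨$⟩ʳ point (k , i) ≡ point (k , suc (toℕ i) mod d)

{-# OPTIONS --safe #-}
-- Write points as (k , i), where i ∈ ℤ/d is the position in the k-th cycle,
-- and let σ = (ε, ε, γ; (123)).  Since σ³ = (γ, γ, γ; ε), every ⟨σ³⟩-orbit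
-- on O(L) has a unique triple whose first coordinate is of the form (i , 0),
-- so the r²d orbits are labelled by (i , j , b), where (j , b) is the second
-- coordinate of that triple.  On labels σ induces a map τ with τ³ = 1, and the
-- b's of t, τt and τ²t add up to −1 modulo d.
--
-- Summing over all labels gives 3 ∑ b ≡ − r²d ≡ 0 (mod d), while
-- ∑ b = r² d (d − 1) / 2; so r is even if d is.  If 3 ∣ d then τ has no fixed
-- point (3 b ≡ −1 is impossible); summing over the E = r²d / 3 orbits of τ
-- gives ∑ b ≡ − E (mod d), hence d ∣ 2 E, and 3 ∣ r.
module Submission where

open import Defs
open import Data.Bool.Base using (if_then_else_)
open import Data.Fin.Base using (Fin; toℕ; opposite)
open import Data.Fin.Permutation using (Permutation′; id; _⟨$⟩ʳ_)
open import Data.Fin.Properties using (toℕ-injective; toℕ-fromℕ<; toℕ<n; opposite-prop; opposite-involutive; *↔×)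
open import Data.Nat.Base using (ℕ; zero; suc; _+_; _*_; _∸_; _<_; NonZero)
open import Data.Nat.Divisibility using (_∣_; divides; divides-refl; _∣0; ∣-trans; ∣m∣n⇒∣m+n; ∣m+n∣m⇒∣n; ∣n⇒∣m*n; m∣m*n; n∣m*n; >⇒∤)
open import Data.Nat.DivMod using (_mod_; _%_; _/_; m≡m%n+[m/n]*n; m%n%n≡m%n; m<n⇒m%n≡m; [m+n]%n≡m%n; %-distribˡ-+; %-remove-+ʳ)
open import Data.Nat.LCM using (lcm-least)
open import Data.Nat.Primality using (Prime; prime?; prime[2]; euclidsLemma)
open import Data.Nat.Properties
open import Data.Nat.Tactic.RingSolver using (solve-∀)
open import Data.Product using (_×_; _,_; proj₁; proj₂)
open import Data.Product.Function.NonDependent.Propositional using (_×-↔_)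
open import Data.Sum.Base using (inj₁; inj₂; reduce)
open import Data.Vec.Base using ([]; _∷_)
open import Function.Base using (_∘_)
open import Function.Bundles using (_↔_; Inverse; Injection; mk↔ₛ′)
open import Function.Construct.Composition using (_↔-∘_)
open import Function.Construct.Identity using (↔-id)
open import Function.Construct.Symmetry using (↔-sym)
open import Function.Properties.Inverse using (↔⇒↣)
open import Relation.Binary.Definitions using (tri<; tri≈; tri>)
open import Relation.Binary.PropositionalEquality using (_≡_; _≢_; refl; sym; trans; cong; cong₂; subst; module ≡-Reasoning)
open import Relation.Nullary using (¬_; does; contradiction)
open import Relation.Nullary.Decidable using (toWitness; dec-true; dec-false)
open import Relation.Unary using (_∈_)

open import Algebra.Properties.CommutativeMonoid.Sum +-0-commutativeMonoid as Sum using (sum; sum-cong-≗)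

-- Sums over an enumerated type

module Summation {A : Set} {N : ℕ} (enum : Fin N ↔ A) where

  private
    at = Inverse.to enum

  ∑ : (A → ℕ) → ℕ
  ∑ f = sum (f ∘ at)

  ∑-cong : ∀ {f g : A → ℕ} → (∀ t → f t ≡ g t) → ∑ f ≡ ∑ g
  ∑-cong f≗g = sum-cong-≗ (f≗g ∘ at)

  ∑-+ : ∀ (f g : A → ℕ) → ∑ (λ t → f t + g t) ≡ ∑ f + ∑ g
  ∑-+ f g = Sum.∑-distrib-+ (f ∘ at) (g ∘ at)

  ∑-const : ∀ c → ∑ (λ _ → c) ≡ N * c
  ∑-const c = sum-const N
    where
    sum-const : ∀ m → sum {m} (λ _ → c) ≡ m * c
    sum-const zero    = refl
    sum-const (suc m) = cong (c +_) (sum-const m)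

  ∑-∣ : ∀ {d} {f : A → ℕ} → (∀ t → d ∣ f t) → d ∣ ∑ f
  ∑-∣ d∣f = sum-∣ (d∣f ∘ at)
    where
    sum-∣ : ∀ {d m} {f : Fin m → ℕ} → (∀ i → d ∣ f i) → d ∣ sum f
    sum-∣ {m = zero}  d∣f = _ ∣0
    sum-∣ {m = suc m} d∣f = ∣m∣n⇒∣m+n (d∣f Fin.zero) (sum-∣ (d∣f ∘ Fin.suc))

  ∑-permute : ∀ (f : A → ℕ) (π : A ↔ A) → ∑ f ≡ ∑ (f ∘ Inverse.to π)
  ∑-permute f π = trans
    (Sum.sum-permute (f ∘ at) (↔-sym enum ↔-∘ (π ↔-∘ enum)))
    (sum-cong-≗ λ i → cong f (Inverse.strictlyInverseˡ enum (Inverse.to π (at i))))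

-- Maps of order three

-- An Iverson bracket with values in `ℕ`, so that choosing one element per orbit becomes a weight
-- inside a sum.
[_<_] : ℕ → ℕ → ℕ
[ m < n ] = if does (m <? n) then 1 else 0

[<]≡1 : ∀ {m n} → m < n → [ m < n ] ≡ 1
[<]≡1 {m} {n} m<n = cong (if_then 1 else 0) (dec-true (m <? n) m<n)

[>]≡0 : ∀ {m n} → n < m → [ m < n ] ≡ 0
[>]≡0 {m} {n} n<m = cong (if_then 1 else 0) (dec-false (m <? n) (<-asym n<m))

isLeast : ℕ → ℕ → ℕ → ℕ
isLeast m n o = [ m < n ] * [ m < o ]

-- Comparing along the cycle m, n, o, the two all-equal-direction patterns contradict transitivity;
-- each of the other six singles out one minimum.
exactlyOneLeast : ∀ {m n o} → m ≢ n → n ≢ o → o ≢ m →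
                  isLeast m n o + isLeast n o m + isLeast o m n ≡ 1
exactlyOneLeast {m} {n} {o} m≢n n≢o o≢m with <-cmp m n | <-cmp n o | <-cmp o m
... | tri≈ _ m≡n _ | _            | _            = contradiction m≡n m≢n
... | tri< _ _ _   | tri≈ _ n≡o _ | _            = contradiction n≡o n≢o
... | tri> _ _ _   | tri≈ _ n≡o _ | _            = contradiction n≡o n≢o
... | tri< _ _ _   | tri< _ _ _   | tri≈ _ o≡m _ = contradiction o≡m o≢m
... | tri< _ _ _   | tri> _ _ _   | tri≈ _ o≡m _ = contradiction o≡m o≢m
... | tri> _ _ _   | tri< _ _ _   | tri≈ _ o≡m _ = contradiction o≡m o≢m
... | tri> _ _ _   | tri> _ _ _   | tri≈ _ o≡m _ = contradiction o≡m o≢m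
... | tri< a _ _   | tri< b _ _   | tri< c _ _   = contradiction (<-trans a (<-trans b c)) (<-irrefl refl)
... | tri> _ _ a   | tri> _ _ b   | tri> _ _ c   = contradiction (<-trans c (<-trans b a)) (<-irrefl refl)
... | tri< a _ _   | tri< b _ _   | tri> _ _ c
  rewrite [<]≡1 a | [>]≡0 a | [<]≡1 b | [>]≡0 b | [<]≡1 c | [>]≡0 c = refl
... | tri< a _ _   | tri> _ _ b   | tri< c _ _
  rewrite [<]≡1 a | [>]≡0 a | [<]≡1 b | [>]≡0 b | [<]≡1 c | [>]≡0 c = refl
... | tri< a _ _   | tri> _ _ b   | tri> _ _ c
  rewrite [<]≡1 a | [>]≡0 a | [<]≡1 b | [>]≡0 b | [<]≡1 c | [>]≡0 c = refl
... | tri> _ _ a   | tri< b _ _   | tri< c _ _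
  rewrite [<]≡1 a | [>]≡0 a | [<]≡1 b | [>]≡0 b | [<]≡1 c = refl
... | tri> _ _ a   | tri< b _ _   | tri> _ _ c
  rewrite [<]≡1 a | [>]≡0 a | [<]≡1 b | [>]≡0 c = refl
... | tri> _ _ a   | tri> _ _ b   | tri< c _ _
  rewrite [<]≡1 a | [>]≡0 a | [<]≡1 b | [>]≡0 b | [<]≡1 c = refl

module OrderThree {A : Set} {N : ℕ} (enum : Fin N ↔ A)
                  (τ : A → A) (τ³ : ∀ t → τ (τ (τ t)) ≡ t) where

  open Summation enum
  open ≡-Reasoning

  private
    π π² : A ↔ A
    π  = mk↔ₛ′ τ (τ ∘ τ) τ³ τ³
    π² = mk↔ₛ′ (τ ∘ τ) τ τ³ τ³

  orbitSum : (A → ℕ) → A → ℕ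
  orbitSum f t = f t + f (τ t) + f (τ (τ t))

  ∑-orbitSum : ∀ f → ∑ (orbitSum f) ≡ 3 * ∑ f
  ∑-orbitSum f = begin
    ∑ (orbitSum f)
      ≡⟨ ∑-+ (λ t → f t + f (τ t)) (f ∘ τ ∘ τ) ⟩
    ∑ (λ t → f t + f (τ t)) + ∑ (f ∘ τ ∘ τ)
      ≡⟨ cong (_+ ∑ (f ∘ τ ∘ τ)) (∑-+ f (f ∘ τ)) ⟩
    ∑ f + ∑ (f ∘ τ) + ∑ (f ∘ τ ∘ τ)
      ≡⟨ cong₂ (λ u v → ∑ f + u + v) (∑-permute f π) (∑-permute f π²) ⟨
    ∑ f + ∑ f + ∑ f
      ≡⟨ triple (∑ f) ⟩
    3 * ∑ f ∎
    where
    triple : ∀ s → s + s + s ≡ 3 * s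
    triple = solve-∀

  module FixedPointFree (τt≢t : ∀ t → τ t ≢ t) where

    private
      index : A → ℕ
      index = toℕ ∘ Inverse.from enum

      index-injective : ∀ {s t} → index s ≡ index t → s ≡ t
      index-injective = Injection.injective (↔⇒↣ (↔-sym enum)) ∘ toℕ-injective

    -- The indicator function of a set of representatives of the orbits of τ.
    rep : A → ℕ
    rep t = isLeast (index t) (index (τ t)) (index (τ (τ t)))

    -- By `τ³`, the three terms are `isLeast` on the rotations of one triple of indices, pairwise
    -- distinct because `τ` has no fixed point.
    orbitSum-rep : ∀ t → orbitSum rep t ≡ 1
    orbitSum-rep t rewrite τ³ t = exactlyOneLeast
      (λ eq → τt≢t t (sym (index-injective eq)))
      (λ eq → τt≢t (τ t) (sym (index-injective eq)))
      (λ eq → τt≢t (τ (τ t)) (trans (τ³ t) (sym (index-injective eq))))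

    3*∑-rep : 3 * ∑ rep ≡ N
    3*∑-rep = begin
      3 * ∑ rep        ≡⟨ ∑-orbitSum rep ⟨
      ∑ (orbitSum rep) ≡⟨ ∑-cong orbitSum-rep ⟩
      ∑ (λ _ → 1)      ≡⟨ ∑-const 1 ⟩
      N * 1            ≡⟨ *-identityʳ N ⟩
      N                ∎

    -- Reindexing by a power of `τ` moves `τ` from `f` onto `rep`, and the resulting weight
    -- `orbitSum rep` is constantly 1.
    ∑-rep*orbitSum : ∀ f → ∑ (λ t → rep t * orbitSum f t) ≡ ∑ f
    ∑-rep*orbitSum f = begin
      ∑ (λ t → rep t * orbitSum f t)
        ≡⟨ ∑-cong (λ t → expandˡ (rep t) (f t) (f (τ t)) (f (τ (τ t)))) ⟩
      ∑ (λ t → rep t * f t + rep t * f (τ t) + rep t * f (τ (τ t)))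
        ≡⟨ ∑-+₃ (λ t → rep t * f t) (λ t → rep t * f (τ t)) (λ t → rep t * f (τ (τ t))) ⟩
      ∑ (λ t → rep t * f t) + ∑ (λ t → rep t * f (τ t)) + ∑ (λ t → rep t * f (τ (τ t)))
        ≡⟨ cong₂ (λ u v → ∑ (λ t → rep t * f t) + u + v)
             (trans (∑-permute (λ t → rep t * f (τ t)) π²)
                    (∑-cong λ t → cong (λ s → rep (τ (τ t)) * f s) (τ³ t)))
             (trans (∑-permute (λ t → rep t * f (τ (τ t))) π)
                    (∑-cong λ t → cong (λ s → rep (τ t) * f s) (τ³ t))) ⟩
      ∑ (λ t → rep t * f t) + ∑ (λ t → rep (τ (τ t)) * f t) + ∑ (λ t → rep (τ t) * f t)
        ≡⟨ ∑-+₃ (λ t → rep t * f t) (λ t → rep (τ (τ t)) * f t) (λ t → rep (τ t) * f t) ⟨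
      ∑ (λ t → rep t * f t + rep (τ (τ t)) * f t + rep (τ t) * f t)
        ≡⟨ ∑-cong (λ t → expandʳ (rep t) (rep (τ t)) (rep (τ (τ t))) (f t)) ⟨
      ∑ (λ t → orbitSum rep t * f t)
        ≡⟨ ∑-cong (λ t → trans (cong (_* f t) (orbitSum-rep t)) (*-identityˡ (f t))) ⟩
      ∑ f ∎
      where
      expandˡ : ∀ e x y z → e * (x + y + z) ≡ e * x + e * y + e * z
      expandˡ = solve-∀
      expandʳ : ∀ x y z e → (x + y + z) * e ≡ x * e + z * e + y * e
      expandʳ = solve-∀
      ∑-+₃ : ∀ f g h → ∑ (λ t → f t + g t + h t) ≡ ∑ f + ∑ g + ∑ h
      ∑-+₃ f g h = trans (∑-+ (λ t → f t + g t) h) (cong (_+ ∑ h) (∑-+ f g))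

-- Arithmetic

toℕ-mod : ∀ m d .{{_ : NonZero d}} → toℕ (m mod d) ≡ m % d
toℕ-mod m d = toℕ-fromℕ< _

%-+ˡ : ∀ m n d .{{_ : NonZero d}} → (m % d + n) % d ≡ (m + n) % d
%-+ˡ m n d = begin
  (m % d + n) % d         ≡⟨ %-distribˡ-+ (m % d) n d ⟩
  (m % d % d + n % d) % d ≡⟨ cong (λ u → (u + n % d) % d) (m%n%n≡m%n m d) ⟩
  (m % d + n % d) % d     ≡⟨ %-distribˡ-+ m n d ⟨
  (m + n) % d             ∎
  where open ≡-Reasoning

mod-cong : ∀ {m n d} .{{_ : NonZero d}} → m % d ≡ n % d → m mod d ≡ n mod d
mod-cong {m} {n} {d} eq = toℕ-injective (trans (toℕ-mod m d) (trans eq (sym (toℕ-mod n d))))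

-- Thus `opposite` acts as the map from `i` to -1 - `i` modulo `d`.
toℕ-+-opposite : ∀ {d} (i : Fin d) → toℕ i + suc (toℕ (opposite i)) ≡ d
toℕ-+-opposite {d} i = begin
  toℕ i + suc (toℕ (opposite i)) ≡⟨ +-suc (toℕ i) _ ⟩
  suc (toℕ i) + toℕ (opposite i) ≡⟨ cong (suc (toℕ i) +_) (opposite-prop i) ⟩
  suc (toℕ i) + (d ∸ suc (toℕ i)) ≡⟨ m+[n∸m]≡n (toℕ<n i) ⟩
  d ∎
  where open ≡-Reasoning

-- Reduce `i + m + j` modulo `d` in two ways, dropping either multiple of `d`.
∣-+-cancel-Fin : ∀ {d} .{{_ : NonZero d}} m (i j : Fin d) → d ∣ m + toℕ i → d ∣ m + toℕ j → i ≡ j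
∣-+-cancel-Fin {d} m i j d∣m+i d∣m+j = toℕ-injective (begin
  toℕ i                     ≡⟨ m<n⇒m%n≡m (toℕ<n i) ⟨
  toℕ i % d                 ≡⟨ %-remove-+ʳ (toℕ i) d∣m+j ⟨
  (toℕ i + (m + toℕ j)) % d ≡⟨ cong (_% d) (swap (toℕ i) m (toℕ j)) ⟩
  (toℕ j + (m + toℕ i)) % d ≡⟨ %-remove-+ʳ (toℕ j) d∣m+i ⟩
  toℕ j % d                 ≡⟨ m<n⇒m%n≡m (toℕ<n j) ⟩
  toℕ j                     ∎)
  where
  open ≡-Reasoning
  swap : ∀ x y z → x + (y + z) ≡ z + (y + x)
  swap = solve-∀

prime∣²⇒∣ : ∀ {p} → Prime p → ∀ m → p ∣ m * m → p ∣ m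
prime∣²⇒∣ pr m p∣m² = reduce (euclidsLemma m m pr p∣m²)

prime[3] : Prime 3
prime[3] = toWitness {a? = prime? 3} _

-- Divisors of r from identities between sums

module _ {d r : ℕ} .{{_ : NonZero d}} where

  private
    N = r * (r * d)

  d∣r*[r*d] : d ∣ N
  d∣r*[r*d] = ∣n⇒∣m*n r (n∣m*n r)

  -- Tripling the last identity makes every term a multiple of `d`; cancelling one `d` and reducing
  -- modulo 2 leaves 3r² even.
  2∣r-of-sum : ∀ S → 2 ∣ d → d ∣ 3 * S → N + 2 * S ≡ N * d → 2 ∣ r
  2∣r-of-sum S 2∣d (divides q 3S≡qd) N+2S≡Nd = prime∣²⇒∣ prime[2] r 2∣r²
    where
    open ≡-Reasoning

    2q+3r²≡3r²d : 2 * q + 3 * (r * r) ≡ 3 * (r * r) * d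
    2q+3r²≡3r²d = *-cancelʳ-≡ _ _ d (begin
      (2 * q + 3 * (r * r)) * d ≡⟨ expand r q d ⟩
      3 * N + 2 * (q * d)       ≡⟨ cong (λ u → 3 * N + 2 * u) 3S≡qd ⟨
      3 * N + 2 * (3 * S)       ≡⟨ collect N S ⟩
      3 * (N + 2 * S)           ≡⟨ cong (3 *_) N+2S≡Nd ⟩
      3 * (N * d)               ≡⟨ reassoc r d ⟩
      3 * (r * r) * d * d       ∎)
      where
      expand : ∀ r q d → (2 * q + 3 * (r * r)) * d ≡ 3 * (r * (r * d)) + 2 * (q * d)
      expand = solve-∀
      collect : ∀ N S → 3 * N + 2 * (3 * S) ≡ 3 * (N + 2 * S)
      collect = solve-∀
      reassoc : ∀ r d → 3 * (r * (r * d) * d) ≡ 3 * (r * r) * d * d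
      reassoc = solve-∀

    2∣3r² : 2 ∣ 3 * (r * r)
    2∣3r² = ∣m+n∣m⇒∣n (subst (2 ∣_) (sym 2q+3r²≡3r²d) (∣n⇒∣m*n (3 * (r * r)) 2∣d)) (m∣m*n q)

    2∣r² : 2 ∣ r * r
    2∣r² with euclidsLemma 3 (r * r) prime[2] 2∣3r²
    ... | inj₁ 2∣3  = contradiction (∣m+n∣m⇒∣n {m = 2} {n = 1} 2∣3 (divides-refl 1)) (>⇒∤ ≤-refl)
    ... | inj₂ 2∣r² = 2∣r²

  -- Eliminating `S` gives `d ∣ 2 * E`. Tripling `2 * E ≡ q * d` and cancelling `d` then gives 2r² =
  -- 3q.
  3∣r-of-sums : ∀ S E → d ∣ E + S → 3 * E ≡ N → N + 2 * S ≡ N * d → 3 ∣ r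
  3∣r-of-sums S E d∣E+S 3E≡N N+2S≡Nd = prime∣²⇒∣ prime[3] r (3∣r² d∣2E)
    where
    open ≡-Reasoning

    d∣2E : d ∣ 2 * E
    d∣2E = ∣m+n∣m⇒∣n
      (subst (d ∣_) (begin
        N + 2 * (E + S)       ≡⟨ split N E S ⟩
        N + 2 * S + 2 * E     ≡⟨ cong (_+ 2 * E) N+2S≡Nd ⟩
        N * d + 2 * E         ∎)
        (∣m∣n⇒∣m+n d∣r*[r*d] (∣n⇒∣m*n 2 d∣E+S)))
      (n∣m*n N)
      where
      split : ∀ N E S → N + 2 * (E + S) ≡ N + 2 * S + 2 * E
      split = solve-∀

    2r²≡q*3 : ∀ q → 2 * E ≡ q * d → 2 * (r * r) ≡ q * 3
    2r²≡q*3 q 2E≡qd = *-cancelʳ-≡ _ _ d (begin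
      2 * (r * r) * d   ≡⟨ reassoc r d ⟩
      2 * N             ≡⟨ cong (2 *_) 3E≡N ⟨
      2 * (3 * E)       ≡⟨ swap E ⟩
      2 * E * 3         ≡⟨ cong (_* 3) 2E≡qd ⟩
      q * d * 3         ≡⟨ swap′ q d ⟩
      q * 3 * d         ∎)
      where
      reassoc : ∀ r d → 2 * (r * r) * d ≡ 2 * (r * (r * d))
      reassoc = solve-∀
      swap : ∀ E → 2 * (3 * E) ≡ 2 * E * 3
      swap = solve-∀
      swap′ : ∀ q d → q * d * 3 ≡ q * 3 * d
      swap′ = solve-∀

    3∣r² : d ∣ 2 * E → 3 ∣ r * r
    3∣r² (divides q 2E≡qd) with euclidsLemma 2 (r * r) prime[3] (divides q (2r²≡q*3 q 2E≡qd))
    ... | inj₁ 3∣2  = contradiction 3∣2 (>⇒∤ ≤-refl)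
    ... | inj₂ 3∣r² = 3∣r²

-- The action of σ on the orbits of σ³

module _ {d r n : ℕ} .{{_ : NonZero d}} (γ : Permutation′ n) (structure : HasCycleStructure γ d r)
         (L : LatinSquare n) (auto : IsAutoparatopism ⟨ id , id , γ ⨾ [123] ⟩ L) where

  open HasCycleStructure structure
  open LatinSquare L using (entry)

  private
    γ^ : ℕ → Fin n → Fin n
    γ^ zero    x = x
    γ^ (suc m) x = γ ⟨$⟩ʳ γ^ m x

  γ^-point : ∀ m k i → γ^ m (point (k , i)) ≡ point (k , (toℕ i + m) mod d)
  γ^-point zero    k i = cong (λ j → point (k , j)) (toℕ-injective (begin
    toℕ i                   ≡⟨ m<n⇒m%n≡m (toℕ<n i) ⟨
    toℕ i % d               ≡⟨ cong (_% d) (+-identityʳ (toℕ i)) ⟨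
    (toℕ i + 0) % d         ≡⟨ toℕ-mod (toℕ i + 0) d ⟨
    toℕ ((toℕ i + 0) mod d) ∎))
    where open ≡-Reasoning
  γ^-point (suc m) k i = begin
    γ ⟨$⟩ʳ γ^ m (point (k , i))                       ≡⟨ cong (γ ⟨$⟩ʳ_) (γ^-point m k i) ⟩
    γ ⟨$⟩ʳ point (k , (toℕ i + m) mod d)              ≡⟨ cyclic k _ ⟩
    point (k , suc (toℕ ((toℕ i + m) mod d)) mod d)   ≡⟨ cong (λ j → point (k , j)) (mod-cong shift) ⟩
    point (k , (toℕ i + suc m) mod d)                 ∎
    where
    open ≡-Reasoning
    shift : suc (toℕ ((toℕ i + m) mod d)) % d ≡ (toℕ i + suc m) % d
    shift = begin
      suc (toℕ ((toℕ i + m) mod d)) % d ≡⟨ cong (λ u → suc u % d) (toℕ-mod (toℕ i + m) d) ⟩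
      suc ((toℕ i + m) % d) % d         ≡⟨ cong (_% d) (+-comm 1 ((toℕ i + m) % d)) ⟩
      ((toℕ i + m) % d + 1) % d         ≡⟨ %-+ˡ (toℕ i + m) 1 d ⟩
      (toℕ i + m + 1) % d               ≡⟨ cong (_% d) (trans (+-comm _ 1) (sym (+-suc (toℕ i) m))) ⟩
      (toℕ i + suc m) % d               ∎

  entry-σ : ∀ {x y z} → entry x y ≡ z → entry (γ ⟨$⟩ʳ z) x ≡ y
  entry-σ {x} {y} {z} eq = proj₁ auto {(γ ⟨$⟩ʳ z) ∷ x ∷ y ∷ []} (x ∷ y ∷ z ∷ [] , eq , refl)

  -- Three applications of σ send (x, y, z) to (γz, x, y), then (γy, γz, x), then (γx, γy, γz).
  entry-γ^ : ∀ m {x y z} → entry x y ≡ z → entry (γ^ m x) (γ^ m y) ≡ γ^ m z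
  entry-γ^ zero    eq = eq
  entry-γ^ (suc m) eq = entry-σ (entry-σ (entry-σ (entry-γ^ m eq)))

  origin : Fin r → Fin n
  origin i = point (i , 0 mod d)

  Label : Set
  Label = Fin r × Fin r × Fin d

  -- The third coordinate of the labelled triple, written as a cycle and a position in it.
  product : Label → Fin r × Fin d
  product (i , y) = Inverse.from cycles (entry (origin i) (point y))

  -- γ ∘ γ^(opposite c) takes (k , c) to (k , 0), so it takes the image
  -- (γ z , x , y) of a labelled triple back to a labelled triple.
  τ : Label → Label
  τ (i , j , b) = let (k , c) = product (i , j , b) in k , i , opposite c

  -- With m = -1 - c, applying `γ^ m` to (γz, x, y) gives positions c + 1 + m = 0 in cycle k, m in
  -- cycle i, and b + m in cycle j. The first two are those of the label `τ (i , j , b)`, so the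
  -- last is its product.
  product-τ : ∀ i j b → let (k , c) = product (i , j , b) in
              product (τ (i , j , b)) ≡ (j , (toℕ b + toℕ (opposite c)) mod d)
  product-τ i j b = begin
    Inverse.from cycles (entry (origin k) (point (i , opposite c)))
      ≡⟨ cong₂ (λ u v → Inverse.from cycles (entry u v)) (sym γz) (sym γx) ⟩
    Inverse.from cycles (entry (γ^ m (γ ⟨$⟩ʳ point (k , c))) (γ^ m (origin i)))
      ≡⟨ cong (Inverse.from cycles) (entry-γ^ m (entry-σ xyz)) ⟩
    Inverse.from cycles (γ^ m (point (j , b)))
      ≡⟨ cong (Inverse.from cycles) (γ^-point m j b) ⟩
    Inverse.from cycles (point (j , (toℕ b + m) mod d))
      ≡⟨ Inverse.strictlyInverseʳ cycles _ ⟩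
    (j , (toℕ b + m) mod d) ∎
    where
    open ≡-Reasoning
    k = proj₁ (product (i , j , b))
    c = proj₂ (product (i , j , b))
    m = toℕ (opposite c)

    xyz : entry (origin i) (point (j , b)) ≡ point (k , c)
    xyz = sym (Inverse.strictlyInverseˡ cycles _)

    γ^-γ : ∀ m x → γ^ m (γ ⟨$⟩ʳ x) ≡ γ^ (suc m) x
    γ^-γ zero    x = refl
    γ^-γ (suc m) x = cong (γ ⟨$⟩ʳ_) (γ^-γ m x)

    γz : γ^ m (γ ⟨$⟩ʳ point (k , c)) ≡ origin k
    γz = begin
      γ^ m (γ ⟨$⟩ʳ point (k , c))       ≡⟨ γ^-γ m (point (k , c)) ⟩
      γ^ (suc m) (point (k , c))        ≡⟨ γ^-point (suc m) k c ⟩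
      point (k , (toℕ c + suc m) mod d) ≡⟨ cong (λ u → point (k , u mod d)) (toℕ-+-opposite c) ⟩
      point (k , d mod d)               ≡⟨ cong (λ u → point (k , u)) (mod-cong ([m+n]%n≡m%n 0 d)) ⟩
      origin k                          ∎

    γx : γ^ m (origin i) ≡ point (i , opposite c)
    γx = trans (γ^-point m i (0 mod d)) (cong (λ u → point (i , u)) (toℕ-injective (begin
      toℕ ((toℕ (0 mod d) + m) mod d) ≡⟨ toℕ-mod _ d ⟩
      (toℕ (0 mod d) + m) % d         ≡⟨ cong (λ u → (u + m) % d) (toℕ-mod 0 d) ⟩
      (0 % d + m) % d                 ≡⟨ %-+ˡ 0 m d ⟩
      m % d                           ≡⟨ m<n⇒m%n≡m (toℕ<n (opposite c)) ⟩
      m                               ∎)))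

  shiftOf : Label → ℕ
  shiftOf (_ , _ , b) = toℕ b

  -- By `product-τ`, the product of `τ t` sits at position `c₂`, the sum of the first two shifts
  -- modulo `d`; the third shift is `opposite c₂`, which is -1 - `c₂`.
  ∣-orbit : ∀ t → d ∣ suc (shiftOf t + shiftOf (τ t) + shiftOf (τ (τ t)))
  ∣-orbit t@(i , j , b) = divides (suc q) (begin
    suc (u + toℕ (opposite c₂))                ≡⟨ +-suc u _ ⟨
    u + suc (toℕ (opposite c₂))                ≡⟨ cong (_+ suc (toℕ (opposite c₂))) (m≡m%n+[m/n]*n u d) ⟩
    u % d + q * d + suc (toℕ (opposite c₂))    ≡⟨ cong (λ v → v + q * d + suc (toℕ (opposite c₂))) c₂≡ ⟨
    toℕ c₂ + q * d + suc (toℕ (opposite c₂))   ≡⟨ rotate (toℕ c₂) (q * d) (suc (toℕ (opposite c₂))) ⟩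
    toℕ c₂ + suc (toℕ (opposite c₂)) + q * d   ≡⟨ cong (_+ q * d) (toℕ-+-opposite c₂) ⟩
    d + q * d                                  ∎)
    where
    open ≡-Reasoning
    u  = toℕ b + shiftOf (τ t)
    q  = u / d
    c₂ = proj₂ (product (τ t))
    c₂≡ : toℕ c₂ ≡ u % d
    c₂≡ = trans (cong (toℕ ∘ proj₂) (product-τ i j b)) (toℕ-mod u d)
    rotate : ∀ x y z → x + y + z ≡ x + z + y
    rotate = solve-∀

  -- The cycle indices return by `product-τ`. For the shift, `∣-orbit` at `t` and at `τ t` share two
  -- summands, so the remaining ones agree modulo `d`.
  τ³≡id : ∀ t → τ (τ (τ t)) ≡ t
  τ³≡id t@(i , j , b) = cong₂ _,_ i₃≡i (cong₂ _,_ j₃≡j b₃≡b)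
    where
    i₃≡i : proj₁ (τ (τ (τ t))) ≡ i
    i₃≡i = cong proj₁ (product-τ _ i _)
    j₃≡j : proj₁ (proj₂ (τ (τ (τ t)))) ≡ j
    j₃≡j = cong proj₁ (product-τ i j b)
    b₃≡b : proj₂ (proj₂ (τ (τ (τ t)))) ≡ b
    b₃≡b = ∣-+-cancel-Fin (suc (shiftOf (τ t) + shiftOf (τ (τ t)))) _ b
      (∣-orbit (τ t))
      (subst (d ∣_) (rotate (toℕ b) (shiftOf (τ t)) (shiftOf (τ (τ t)))) (∣-orbit t))
      where
      rotate : ∀ x y z → suc (x + y + z) ≡ suc (y + z) + x
      rotate = solve-∀

  -- Summing shifts over all labels

  private
    N = r * (r * d)

  labels : Fin N ↔ Label
  labels = (↔-id (Fin r) ×-↔ *↔×) ↔-∘ *↔×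

  open Summation labels
  open OrderThree labels τ τ³≡id

  private
    S = ∑ shiftOf

  ∑-suc : ∀ f → ∑ (suc ∘ f) ≡ N + ∑ f
  ∑-suc f = trans (∑-+ (λ _ → 1) f) (cong (_+ ∑ f) (trans (∑-const 1) (*-identityʳ N)))

  -- Gauss's trick: b ↦ opposite b permutes the labels.
  2*∑-shiftOf : N + 2 * S ≡ N * d
  2*∑-shiftOf = begin
    N + 2 * S                                     ≡⟨ cong (N +_) (double S) ⟩
    N + (S + S)                                   ≡⟨ cong (λ u → N + (S + u)) (∑-permute shiftOf ρ) ⟩
    N + (S + ∑ (shiftOf ∘ Inverse.to ρ))          ≡⟨ cong (N +_) (∑-+ shiftOf (shiftOf ∘ Inverse.to ρ)) ⟨
    N + ∑ (λ t → shiftOf t + shiftOf (Inverse.to ρ t)) ≡⟨ ∑-suc (λ t → shiftOf t + shiftOf (Inverse.to ρ t)) ⟨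
    ∑ (λ t → suc (shiftOf t + shiftOf (Inverse.to ρ t)))
      ≡⟨ ∑-cong (λ { (_ , _ , b) → trans (sym (+-suc (toℕ b) _)) (toℕ-+-opposite b) }) ⟩
    ∑ (λ _ → d)                                   ≡⟨ ∑-const d ⟩
    N * d                                         ∎
    where
    open ≡-Reasoning
    double : ∀ s → 2 * s ≡ s + s
    double = solve-∀
    ρ : Label ↔ Label
    ρ = ↔-id (Fin r) ×-↔ (↔-id (Fin r) ×-↔ mk↔ₛ′ opposite opposite opposite-involutive opposite-involutive)

  2∣d⇒2∣r : 2 ∣ d → 2 ∣ r
  2∣d⇒2∣r 2∣d = 2∣r-of-sum S 2∣d d∣3S 2*∑-shiftOf
    where
    d∣3S : d ∣ 3 * S
    -- Summing `∣-orbit` over all labels gives `d ∣ N + 3 * S`, and `d` divides `N`.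
    d∣3S = ∣m+n∣m⇒∣n
      (subst (d ∣_) (trans (∑-suc (orbitSum shiftOf)) (cong (N +_) (∑-orbitSum shiftOf))) (∑-∣ ∣-orbit))
      (d∣r*[r*d] {d} {r})

  3∣d⇒3∣r : 3 ∣ d → 3 ∣ r
  3∣d⇒3∣r 3∣d = 3∣r-of-sums S E d∣E+S 3*∑-rep 2*∑-shiftOf
    where
    open ≡-Reasoning

    3∤1+3b : ∀ b → ¬ 3 ∣ suc (b + b + b)
    3∤1+3b b 3∣1+3b = contradiction (∣m+n∣m⇒∣n (subst (3 ∣_) (rearrange b) 3∣1+3b) (m∣m*n b)) (>⇒∤ (m≤m+n 2 1))
      where
      rearrange : ∀ b → suc (b + b + b) ≡ 3 * b + 1
      rearrange = solve-∀

    τt≢t : ∀ t → τ t ≢ t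
    -- At a fixed point the three shifts coincide, so `∣-orbit` would make 3 divide 1 + 3b.
    τt≢t t τt≡t = 3∤1+3b (shiftOf t) (subst (3 ∣_)
      (cong₂ (λ u v → suc (shiftOf t + shiftOf u + shiftOf v)) τt≡t (trans (cong τ τt≡t) τt≡t))
      (∣-trans 3∣d (∣-orbit t)))

    open FixedPointFree τt≢t

    E = ∑ rep

    d∣E+S : d ∣ E + S
    -- The weight `rep` counts the relation `∣-orbit` once per `τ`-orbit.
    d∣E+S = subst (d ∣_) (begin
      ∑ (λ t → rep t * suc (orbitSum shiftOf t))     ≡⟨ ∑-cong (λ t → *-suc (rep t) (orbitSum shiftOf t)) ⟩
      ∑ (λ t → rep t + rep t * orbitSum shiftOf t)   ≡⟨ ∑-+ rep (λ t → rep t * orbitSum shiftOf t) ⟩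
      E + ∑ (λ t → rep t * orbitSum shiftOf t)       ≡⟨ cong (E +_) (∑-rep*orbitSum shiftOf) ⟩
      E + S                                          ∎)
      (∑-∣ λ t → ∣n⇒∣m*n (rep t) (∣-orbit t))

-- Combining the primes 2 and 3

theorem5p2 : (d r n : ℕ) .{{_ : NonZero d}} .{{_ : NonZero r}} → n ≡ d * r →
    (γ : Permutation′ n) → HasCycleStructure γ d r →
    ⟨ id , id , γ ⨾ [123] ⟩ ∈ Par n →
    (3 ∣ d → 3 ∣ r) × (6 ∣ d → 6 ∣ r)
theorem5p2 d r n n≡dr γ structure (L , auto) = 3∣⇒3∣ , λ 6∣d →
  lcm-least {2} {3} (2∣d⇒2∣r γ structure L auto (∣-trans (divides-refl 3) 6∣d))
                    (3∣⇒3∣ (∣-trans (divides-refl 2) 6∣d))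
  where
  3∣⇒3∣ : 3 ∣ d → 3 ∣ r
  3∣⇒3∣ = 3∣d⇒3∣r γ structure L auto
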